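{- Let $G$ and $H$ be connected graphs such that at least one of $G$, $H$ has at least three vertices (and each has at least two vertices). Then $\chi_{lid}(G \times H) \leq \chi(G)\,\chi(H)$.
   Context: $\chi(G)$ is the chromatic number of $G$. A proper $k$-coloring of a graph $G$ is a map $f:V(G)\to\{1,\dots,k\}$ with $f(u)\neq f(v)$ for every edge $uv$. For a vertex $v$, $N[v]$ denotes its closed neighborhood ($v$ together with all its neighbors), and $f(S)=\{f(x):x\in S\}$. A locally identifying coloring (lid-coloring) of $G$ is a proper coloring $f$ such that for every edge $uv$ with $N[u]\neq N[v]$ we have $f(N[u])\neq f(N[v])$. The lid-chromatic number $\chi_{lid}(G)$ is the smallest $k$ such that $G$ has a lid-coloring with $k$ colors. The tensor product $G\times H$ has vertex set $V(G)\times V(H)$, where $(u_1,v_1)$ and $(u_2,v_2)$ are adjacent iff $u_1u_2\in E(G)$ and $v_1v_2\in E(H)$. -}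

module Defs where

open import Data.Nat using (ℕ; _≤_; _*_)
open import Data.Fin using (Fin)
open import Data.Product using (Σ; ∃; _×_; _,_)
open import Data.Sum using (_⊎_)
open import Relation.Nullary using (¬_)
open import Relation.Binary.PropositionalEquality using (_≡_)
open import Function.Bundles using (_⇔_)

record Graph : Set₁ where
  field
    n      : ℕ
    Adj    : Fin n → Fin n → Set
    sym    : ∀ {u v} → Adj u v → Adj v u
    irrefl : ∀ {u} → ¬ Adj u u

open Graph public

Vertex : Graph → Set
Vertex G = Fin (n G)

data Reach (G : Graph) : Vertex G → Vertex G → Set where
  here  : ∀ {u} → Reach G u u
  step  : ∀ {u v w} → Adj G u v → Reach G v w → Reach G u w

Connected : Graph → Set
Connected G = ∀ (u v : Vertex G) → Reach G u v

InN : (G : Graph) → Vertex G → Vertex G → Set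
InN G v w = (w ≡ v) ⊎ Adj G v w

Proper : (G : Graph) (k : ℕ) → (Vertex G → Fin k) → Set
Proper G k f = ∀ {u v} → Adj G u v → ¬ (f u ≡ f v)

ColN : (G : Graph) (k : ℕ) → (Vertex G → Fin k) → Vertex G → Fin k → Set
ColN G k f v c = Σ (Vertex G) λ x → InN G v x × (f x ≡ c)

LidColoring : (G : Graph) (k : ℕ) → (Vertex G → Fin k) → Set
LidColoring G k f =
  Proper G k f ×
  (∀ {u v} → Adj G u v →
     ¬ (∀ w → InN G u w ⇔ InN G v w) →
     ¬ (∀ c → ColN G k f u c ⇔ ColN G k f v c))

Colorable : Graph → ℕ → Set
Colorable G k = Σ (Vertex G → Fin k) λ f → Proper G k f

IsChromaticNumber : Graph → ℕ → Set
IsChromaticNumber G k = Colorable G k × (∀ m → Colorable G m → k ≤ m)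

LidAtMost : Graph → ℕ → Set
LidAtMost G k = ∃ λ m → m ≤ k × Σ (Vertex G → Fin m) (LidColoring G m)

open import Data.Fin using (remQuot)
open import Data.Product using (proj₁; proj₂)

tensor : Graph → Graph → Graph
tensor G H = record
  { n = n G * n H
  ; Adj = λ x y → Adj G (proj₁ (remQuot {n G} (n H) x)) (proj₁ (remQuot {n G} (n H) y))
                × Adj H (proj₂ (remQuot {n G} (n H) x)) (proj₂ (remQuot {n G} (n H) y))
  ; sym = λ { (a , b) → sym G a , sym H b }
  ; irrefl = λ { (a , b) → irrefl G a }
  }

{-# OPTIONS --safe #-}

-- If f is a proper coloring of G, then (u , v) ↦ (f u , t v) is a lid-coloring
-- of the tensor product as soon as every edge of H has an endpoint whose open
-- neighborhood receives at least two colors under t, which need not be proper.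
-- If N[(u₁ , v₁)] and N[(u₂ , v₂)] had the same colors, then comparing those
-- with first component f u₁ shows that t is constant on N(v₂), and those with
-- first component f u₂ that t is constant on N(v₁).
--
-- Such a t is read off a spanning tree of H whose root has a grandchild.
-- Adjacency is not decidable, so t uses only the tree edges, and it works
-- whatever the other edges of H are; this is possible since the condition on an
-- endpoint persists when edges are added.

module Submission where

open import Defs
open import Data.Bool using (Bool; true; false; not; if_then_else_)
open import Data.Bool.Properties using (not-¬)
open import Data.Empty using (⊥)
open import Data.Fin using (Fin; zero; suc; combine; remQuot; _≟_)
open import Data.Fin.Properties using (any?; combine-injective; remQuot-combine)
open import Data.List using (List; []; _∷_; allFin)
open import Data.List.Membership.Propositional using (_∈_; _∉_)
open import Data.List.Membership.Propositional.Properties using (∈-allFin)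
open import Data.List.Relation.Unary.Any using (here; there)
open import Data.Nat using (ℕ; zero; suc; _≤_; _*_; s≤s)
open import Data.Nat.Properties using (≤-refl)
open import Data.Product using (Σ; ∃; ∃-syntax; _×_; _,_; proj₁; proj₂; swap)
open import Data.Sum using (_⊎_; inj₁; inj₂)
open import Function using (_∘_; flip)
open import Function.Bundles using (module Equivalence)
open import Relation.Binary.PropositionalEquality as ≡
  using (_≡_; _≢_; refl; cong; subst)
open import Relation.Nullary using (¬_; Dec; yes; no; does; contradiction)
open import Relation.Nullary.Decidable using (dec-true; dec-false)

-- Lid-colorings of a tensor product from separating colorings of a factor.

Mono : (G : Graph) {k : ℕ} → (Vertex G → Fin k) → Vertex G → Set
Mono G t v = ∀ {x y} → Adj G v x → Adj G v y → t x ≡ t y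

Separating : (G : Graph) {k : ℕ} → (Vertex G → Fin k) → Set
Separating G t = ∀ {u v} → Adj G u v → Mono G t u → Mono G t v → ⊥

-- An interface rather than `tensor` itself, so that the two factors can be exchanged while the
-- graph `X` stays the same.
record IsTensor (X G H : Graph) : Set where
  field
    π₁      : Vertex X → Vertex G
    π₂      : Vertex X → Vertex H
    pair    : Vertex G → Vertex H → Vertex X
    π₁-pair : ∀ u v → π₁ (pair u v) ≡ u
    π₂-pair : ∀ u v → π₂ (pair u v) ≡ v
    adj₁    : ∀ {x y} → Adj X x y → Adj G (π₁ x) (π₁ y)
    adj₂    : ∀ {x y} → Adj X x y → Adj H (π₂ x) (π₂ y)
    adj     : ∀ {x y} → Adj G (π₁ x) (π₁ y) → Adj H (π₂ x) (π₂ y) → Adj X x y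

tensor-isTensor : ∀ G H → IsTensor (tensor G H) G H
tensor-isTensor G H = record
  { π₁      = proj₁ ∘ remQuot {n G} (n H)
  ; π₂      = proj₂ ∘ remQuot {n G} (n H)
  ; pair    = combine
  ; π₁-pair = λ u v → cong proj₁ (remQuot-combine u v)
  ; π₂-pair = λ u v → cong proj₂ (remQuot-combine u v)
  ; adj₁    = proj₁
  ; adj₂    = proj₂
  ; adj     = _,_
  }

IsTensor-comm : ∀ {X G H} → IsTensor X G H → IsTensor X H G
IsTensor-comm T = record
  { π₁ = π₂ ; π₂ = π₁ ; pair = flip pair
  ; π₁-pair = flip π₂-pair ; π₂-pair = flip π₁-pair
  ; adj₁ = adj₂ ; adj₂ = adj₁ ; adj = flip adj
  }
  where open IsTensor T

module _ {X G H : Graph} (T : IsTensor X G H) where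
  open IsTensor T

  product-lid : ∀ {k l m} {f : Vertex G → Fin k} {t : Vertex H → Fin l}
    (c : Fin k → Fin l → Fin m) →
    (∀ {a b a′ b′} → c a b ≡ c a′ b′ → a ≡ a′ × b ≡ b′) →
    Proper G k f → Separating H t →
    LidColoring X m (λ x → c (f (π₁ x)) (t (π₂ x)))
  product-lid {m = m} {f} {t} c c-inj f-proper t-sep = F-proper , F-lid
    where
    F : Vertex X → Fin m
    F x = c (f (π₁ x)) (t (π₂ x))

    F-proper : Proper X m F
    F-proper xy = f-proper (adj₁ xy) ∘ proj₁ ∘ c-inj

    -- The vertex `pair (π₁ x) w` is a neighbor of `y`, so its color recurs in the closed
    -- neighborhood of `x`. As `f` is proper, only `x` itself has first color `f (π₁ x)` there.
    absorbed : ∀ {x y} → Adj X x y →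
      (∀ d → ColN X m F y d → ColN X m F x d) →
      ∀ {w} → Adj H (π₂ y) w → t w ≡ t (π₂ x)
    absorbed {x} {y} xy sub {w} yw
      with sub _ (pair (π₁ x) w , inj₂ edge , refl)
      where
      edge : Adj X y (pair (π₁ x) w)
      edge = adj (subst (Adj G _) (≡.sym (π₁-pair _ _)) (adj₁ (sym X xy)))
                 (subst (Adj H _) (≡.sym (π₂-pair _ _)) yw)
    ... | z , inj₁ refl , eq =
      ≡.trans (cong t (≡.sym (π₂-pair _ _))) (≡.sym (proj₂ (c-inj eq)))
    ... | z , inj₂ xz , eq = contradiction
      (≡.sym (≡.trans (proj₁ (c-inj eq)) (cong f (π₁-pair _ _))))
      (f-proper (adj₁ xz))

    F-lid : ∀ {x y} → Adj X x y → _ → ¬ (∀ d → _)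
    F-lid xy _ same = t-sep (adj₂ xy)
      (λ p q → ≡.trans (left p) (≡.sym (left q)))
      (λ p q → ≡.trans (right p) (≡.sym (right q)))
      where
      left  = absorbed (sym X xy) (λ d → Equivalence.to (same d))
      right = absorbed xy (λ d → Equivalence.from (same d))

-- Paths on three vertices in connected graphs.

third : ∀ {m} → 3 ≤ m → (a b : Fin m) → ∃[ x ] x ≢ a × x ≢ b
third (s≤s (s≤s (s≤s _))) zero zero = suc zero , (λ ()) , (λ ())
third (s≤s (s≤s (s≤s _))) zero (suc zero) = suc (suc zero) , (λ ()) , (λ ())
third (s≤s (s≤s (s≤s _))) zero (suc (suc _)) = suc zero , (λ ()) , (λ ())
third (s≤s (s≤s (s≤s _))) (suc zero) zero = suc (suc zero) , (λ ()) , (λ ())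
third (s≤s (s≤s (s≤s _))) (suc (suc _)) zero = suc zero , (λ ()) , (λ ())
third (s≤s (s≤s (s≤s _))) (suc _) (suc _) = zero , (λ ()) , (λ ())

record Cherry (H : Graph) : Set where
  field
    {a b c} : Vertex H
    ab      : Adj H a b
    bc      : Adj H b c
    a≢c     : a ≢ c

-- Follow the walk until it first enters the edge `ab`: the vertex just before that extends the edge
-- to a path.
reach-cherry : ∀ {H a b x} → Adj H a b → Reach H x a → x ≢ a → x ≢ b → Cherry H
reach-cherry ab here x≢a x≢b = contradiction refl x≢a
reach-cherry {H} {a} {b} ab (step {v = y} xy ya) x≢a x≢b with y ≟ a | y ≟ b
... | yes refl | _        = record { ab = xy ; bc = ab ; a≢c = x≢b }
... | no _     | yes refl = record { ab = xy ; bc = sym H ab ; a≢c = x≢a }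
... | no y≢a   | no y≢b   = reach-cherry ab ya y≢a y≢b

neighbor : ∀ {H u v} → Reach H u v → u ≢ v → ∃ (Adj H u)
neighbor here u≢u = contradiction refl u≢u
neighbor (step uv _) _ = _ , uv

cherry : ∀ {H} → Connected H → 3 ≤ n H → Cherry H
cherry conn 3≤n@(s≤s _) =
  let y , y≢0 , _   = third 3≤n zero zero
      b , 0b        = neighbor (conn zero y) (y≢0 ∘ ≡.sym)
      x , x≢0 , x≢b = third 3≤n zero b
  in reach-cherry 0b (conn x zero) x≢0 x≢b

-- Growing a spanning tree.

-- The grandchild rules out a star centred at the root: it ensures that the root,
-- too, has a non-leaf neighbor.
record Tree (H : Graph) (L : List (Vertex H)) : Set where
  field
    root       : Vertex H
    par        : Vertex H → Vertex H
    depth      : Vertex H → ℕ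
    root∈      : root ∈ L
    par∈       : ∀ {v} → v ∈ L → par v ∈ L
    par-root   : par root ≡ root
    par-adj    : ∀ {v} → v ∈ L → v ≢ root → Adj H v (par v)
    depth-par  : ∀ {v} → v ∈ L → v ≢ root → depth v ≡ suc (depth (par v))
    grandchild : Vertex H
    grand∈     : grandchild ∈ L
    par-grand  : par grandchild ≢ root
    par²-grand : par (par grandchild) ≡ root

module _ {V : Set} {m : ℕ} where

  _[_≔_] : (Fin m → V) → Fin m → V → Fin m → V
  (g [ x ≔ y ]) v = if does (v ≟ x) then y else g v

  updated : ∀ (g : Fin m → V) x {y} → (g [ x ≔ y ]) x ≡ y
  updated g x with x ≟ x
  ... | yes _  = refl
  ... | no x≢x = contradiction refl x≢x

  unchanged : ∀ (g : Fin m → V) {x y v} → v ≢ x → (g [ x ≔ y ]) v ≡ g v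
  unchanged g {x} {y} {v} v≢x with v ≟ x
  ... | yes v≡x = contradiction v≡x v≢x
  ... | no _    = refl

∈-∉-≢ : ∀ {V : Set} {L : List V} {u v} → u ∈ L → v ∉ L → u ≢ v
∈-∉-≢ u∈ v∉ refl = v∉ u∈

-- Rooting the path at its end `a` makes `c` a grandchild, which remains one when leaves are
-- attached later.
cherry-tree : ∀ {H} (C : Cherry H) → let open Cherry C in
  Tree H (c ∷ b ∷ a ∷ [])
cherry-tree {H} C = record
  { root       = a
  ; par        = par
  ; depth      = depth
  ; root∈      = there (there (here refl))
  ; par∈       = λ
    { (here refl) → there (here par-c)
    ; (there (here refl)) → there (there (here par-b))
    ; (there (there (here refl))) → there (there (here par-a)) }
  ; par-root   = par-a
  ; par-adj    = λ
    { (here refl) _ → subst (Adj H c) (≡.sym par-c) (sym H bc)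
    ; (there (here refl)) _ → subst (Adj H b) (≡.sym par-b) (sym H ab)
    ; (there (there (here refl))) a≢a → contradiction refl a≢a }
  ; depth-par  = λ
    { (here refl) _ → ≡.trans depth-c
        (cong suc (≡.sym (≡.trans (cong depth par-c) depth-b)))
    ; (there (here refl)) _ → ≡.trans depth-b
        (cong suc (≡.sym (≡.trans (cong depth par-b) depth-a)))
    ; (there (there (here refl))) a≢a → contradiction refl a≢a }
  ; grandchild = c
  ; grand∈     = here refl
  ; par-grand  = b≢a ∘ ≡.trans (≡.sym par-c)
  ; par²-grand = ≡.trans (cong par par-c) par-b
  }
  where
  open Cherry C
  b≢a : b ≢ a
  b≢a refl = irrefl H ab
  b≢c : b ≢ c
  b≢c refl = irrefl H bc

  par : Vertex H → Vertex H
  par = (λ _ → a) [ c ≔ b ]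
  par-a : par a ≡ a
  par-a = unchanged (λ _ → a) a≢c
  par-b : par b ≡ a
  par-b = unchanged (λ _ → a) b≢c
  par-c : par c ≡ b
  par-c = updated (λ _ → a) c

  depth₁ depth : Vertex H → ℕ
  depth₁ = (λ _ → 0) [ b ≔ 1 ]
  depth = depth₁ [ c ≔ 2 ]
  depth-a : depth a ≡ 0
  depth-a = ≡.trans (unchanged depth₁ a≢c) (unchanged (λ _ → 0) (b≢a ∘ ≡.sym))
  depth-b : depth b ≡ 1
  depth-b = ≡.trans (unchanged depth₁ b≢c) (updated (λ _ → 0) b)
  depth-c : depth c ≡ 2
  depth-c = updated depth₁ c

-- Since `x` lies outside `L` while parents of vertices in `L` lie inside, the updates at `x`
-- disturb none of the old equations.
attach : ∀ {H L x y} → Tree H L → y ∈ L → x ∉ L → Adj H x y → Tree H (x ∷ L)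
attach {H} {L} {x} {y} T y∈ x∉ xy = record
  { root       = root
  ; par        = par′
  ; depth      = depth′
  ; root∈      = there root∈
  ; par∈       = λ
    { (here refl) → there (subst (_∈ L) (≡.sym par-new) y∈)
    ; (there v∈) → there (subst (_∈ L) (≡.sym (par-old v∈)) (par∈ v∈)) }
  ; par-root   = ≡.trans (par-old root∈) par-root
  ; par-adj    = λ
    { (here refl) _ → subst (Adj H x) (≡.sym par-new) xy
    ; (there v∈) v≢r → subst (Adj H _) (≡.sym (par-old v∈)) (par-adj v∈ v≢r) }
  ; depth-par  = λ
    { (here refl) _ → ≡.trans (updated depth x)
        (cong suc (≡.sym (≡.trans (cong depth′ par-new) (depth-old y∈))))
    ; (there v∈) v≢r → ≡.trans (depth-old v∈) (≡.trans (depth-par v∈ v≢r)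
        (cong suc (≡.sym (≡.trans (cong depth′ (par-old v∈)) (depth-old (par∈ v∈)))))) }
  ; grandchild = grandchild
  ; grand∈     = there grand∈
  ; par-grand  = par-grand ∘ ≡.trans (≡.sym (par-old grand∈))
  ; par²-grand = ≡.trans (cong par′ (par-old grand∈))
                   (≡.trans (par-old (par∈ grand∈)) par²-grand)
  }
  where
  open Tree T
  par′ : Vertex H → Vertex H
  par′ = par [ x ≔ y ]
  depth′ : Vertex H → ℕ
  depth′ = depth [ x ≔ suc (depth y) ]
  par-new : par′ x ≡ y
  par-new = updated par x
  par-old : ∀ {v} → v ∈ L → par′ v ≡ par v
  par-old v∈ = unchanged par (∈-∉-≢ v∈ x∉)
  depth-old : ∀ {v} → v ∈ L → depth′ v ≡ depth v
  depth-old v∈ = unchanged depth (∈-∉-≢ v∈ x∉)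

module _ {H : Graph} where
  open import Data.List.Membership.DecPropositional (_≟_ {n H}) using (_∈?_)
  open import Data.List.Relation.Binary.Subset.Propositional using (_⊆_)
  open import Data.List.Relation.Binary.Subset.Propositional.Properties
    using (⊆-refl; ⊆-trans)

  -- The walk is processed from its end in the tree: each vertex not yet covered is hung below its
  -- successor.
  cover : ∀ {L r v} → Tree H L → r ∈ L → Reach H v r →
    ∃[ L′ ] L ⊆ L′ × v ∈ L′ × Tree H L′
  cover T r∈ here = _ , ⊆-refl , r∈ , T
  cover {v = v} T r∈ (step vy yr) with cover T r∈ yr
  ... | L′ , L⊆L′ , y∈ , T′ with v ∈? L′
  ...   | yes v∈ = L′ , L⊆L′ , v∈ , T′
  ...   | no v∉  = v ∷ L′ , there ∘ L⊆L′ , here refl , attach T′ y∈ v∉ vy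

  coverAll : ∀ {L} → Connected H → Tree H L → (vs : List (Vertex H)) →
    ∃[ L′ ] L ⊆ L′ × (∀ {v} → v ∈ vs → v ∈ L′) × Tree H L′
  coverAll conn T [] = _ , ⊆-refl , (λ ()) , T
  coverAll conn T (v ∷ vs) with cover T (Tree.root∈ T) (conn v _)
  ... | L₁ , L⊆L₁ , v∈ , T₁ with coverAll conn T₁ vs
  ...   | L₂ , L₁⊆L₂ , vs⊆ , T₂ =
    L₂ , ⊆-trans L⊆L₁ L₁⊆L₂ ,
    (λ { (here refl) → L₁⊆L₂ v∈ ; (there w∈) → vs⊆ w∈ }) , T₂

  spanningTree : Connected H → 3 ≤ n H → ∃[ L ] (∀ v → v ∈ L) × Tree H L
  spanningTree conn 3≤n
    with coverAll conn (cherry-tree (cherry conn 3≤n)) (allFin (n H))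
  ... | L , _ , all∈ , T = L , (λ v → all∈ (∈-allFin v)) , T

-- Separating colorings read off a spanning tree.

-- The pattern true, true, false, false of period four: depths two apart always get opposite values.
alternate : ℕ → Bool
alternate zero          = true
alternate (suc zero)    = true
alternate (suc (suc d)) = not (alternate d)

module SpanningTree {H : Graph} {L : List (Vertex H)}
  (∈L : ∀ v → v ∈ L) (T : Tree H L) where
  open Tree T

  -- The root counts as internal already by `par-root`; any other internal vertex has a genuine
  -- child.
  Internal : Vertex H → Set
  Internal v = ∃[ w ] par w ≡ v

  internal? : ∀ v → Dec (Internal v)
  internal? v = any? (λ w → par w ≟ v)

  -- The parent serves away from the root, and `par grandchild` at the root.
  internal-neighbor : ∀ v → ∃[ w ] Internal w × Adj H v w
  internal-neighbor v with v ≟ root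
  ... | no v≢r   = par v , (v , refl) , par-adj (∈L v) v≢r
  ... | yes refl = par grandchild , (grandchild , refl) ,
    sym H (subst (Adj H _) par²-grand (par-adj (∈L _) par-grand))

  -- The parent and a child of `v` are two neighbors that `alternate` tells apart.
  internal-path : ∀ {v} → v ≢ root → Internal v →
    ∃[ w ] Adj H v (par v) × Adj H v w × depth w ≡ suc (suc (depth (par v)))
  internal-path {v} v≢r (w , refl) =
    w , par-adj (∈L v) v≢r , sym H (par-adj (∈L w) w≢r) ,
    ≡.trans (depth-par (∈L w) w≢r) (cong suc (depth-par (∈L v) v≢r))
    where
    w≢r : w ≢ root
    w≢r refl = v≢r par-root

  alternate-depth : ∀ {w v} → depth w ≡ suc (suc (depth v)) →
    alternate (depth v) ≢ alternate (depth w)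
  alternate-depth {w} {v} eq same =
    not-¬ {alternate (depth v)} refl
      (≡.trans same (cong alternate eq))

  -- Leaves get 0 and all other vertices 1 or 2, so a neighbor of a leaf sees 0
  -- and, at an internal neighbor, another color.
  module ThreeColors (m : ℕ) where

    shade : Bool → Fin (suc (suc (suc m)))
    shade true  = suc zero
    shade false = suc (suc zero)

    shade-injective : ∀ {p q} → shade p ≡ shade q → p ≡ q
    shade-injective {true}  {true}  _ = refl
    shade-injective {false} {false} _ = refl

    shade≢0 : ∀ {p} → zero ≢ shade p
    shade≢0 {true}  ()
    shade≢0 {false} ()

    t : Vertex H → Fin (suc (suc (suc m)))
    t v = if does (internal? v) then shade (alternate (depth v)) else zero

    t-internal : ∀ {v} → Internal v → t v ≡ shade (alternate (depth v))
    t-internal {v} i rewrite dec-true (internal? v) i = refl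

    t-leaf : ∀ {v} → ¬ Internal v → t v ≡ zero
    t-leaf {v} ¬i rewrite dec-false (internal? v) ¬i = refl

    -- The parent of `v` is internal and so has a nonzero color. An internal child gets the opposite
    -- shade, a leaf child gets 0.
    internal-¬Mono : ∀ {v} → v ≢ root → Internal v → ¬ Mono H t v
    internal-¬Mono {v} v≢r i mono with internal-path v≢r i
    ... | w , v-par , vw , dw with internal? w
    ...   | yes j = alternate-depth dw (shade-injective
              (≡.trans (≡.sym (t-internal (v , refl)))
                (≡.trans (mono v-par vw) (t-internal j))))
    ...   | no ¬j = shade≢0
              (≡.trans (≡.sym (t-leaf ¬j))
                (≡.trans (mono vw v-par) (t-internal (v , refl))))

    leaf-neighbor-¬Mono : ∀ {u v} → ¬ Internal u → Adj H v u → ¬ Mono H t v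
    leaf-neighbor-¬Mono {v = v} ¬i vu mono with internal-neighbor v
    ... | w , j , vw = shade≢0
      (≡.trans (≡.sym (t-leaf ¬i)) (≡.trans (mono vu vw) (t-internal j)))

    separating : Separating H t
    separating {u} {v} uv mono-u mono-v with internal? u | internal? v
    ... | no ¬i | _     = leaf-neighbor-¬Mono ¬i (sym H uv) mono-v
    ... | yes _ | no ¬j = leaf-neighbor-¬Mono ¬j uv mono-u
    -- Adjacent vertices are distinct, so one of the two internal ends is not the root.
    ... | yes i | yes j with u ≟ root | v ≟ root
    ...   | no u≢r   | _        = internal-¬Mono u≢r i mono-u
    ...   | yes _    | no v≢r   = internal-¬Mono v≢r j mono-v
    ...   | yes refl | yes refl = irrefl H uv

  -- The root's side alternates with depth, so that every internal vertex on the
  -- far side sees both colors. Far leaves get another color than far internal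
  -- vertices, so that a neighbor of a far leaf sees both colors as well.
  module TwoColors (h : Vertex H → Fin 2) (h-proper : Proper H 2 h) where

    Near : Vertex H → Set
    Near v = h v ≡ h root

    bit : Bool → Fin 2
    bit true  = suc zero
    bit false = zero

    bit-injective : ∀ {p q} → bit p ≡ bit q → p ≡ q
    bit-injective {true}  {true}  _ = refl
    bit-injective {false} {false} _ = refl

    t : Vertex H → Fin 2
    t v = bit (if does (h v ≟ h root) then alternate (depth v)
                                      else does (internal? v))

    t-near : ∀ {v} → Near v → t v ≡ bit (alternate (depth v))
    t-near {v} e rewrite dec-true (h v ≟ h root) e = refl

    t-far-internal : ∀ {v} → ¬ Near v → Internal v → t v ≡ suc zero
    t-far-internal {v} ¬e i
      rewrite dec-false (h v ≟ h root) ¬e | dec-true (internal? v) i = refl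

    t-far-leaf : ∀ {v} → ¬ Near v → ¬ Internal v → t v ≡ zero
    t-far-leaf {v} ¬e ¬i
      rewrite dec-false (h v ≟ h root) ¬e | dec-false (internal? v) ¬i = refl

    pigeon : ∀ {a b c : Fin 2} → a ≢ b → a ≢ c → b ≡ c
    pigeon {zero}     {zero}     p _ = contradiction refl p
    pigeon {zero}     {suc zero} {zero}     _ q = contradiction refl q
    pigeon {zero}     {suc zero} {suc zero} _ _ = refl
    pigeon {suc zero} {suc zero} p _ = contradiction refl p
    pigeon {suc zero} {zero}     {suc zero} _ q = contradiction refl q
    pigeon {suc zero} {zero}     {zero}     _ _ = refl

    far-neighbor : ∀ {u v} → Adj H u v → ¬ Near u → Near v
    far-neighbor uv far = pigeon (h-proper uv) far

    near-neighbor : ∀ {u v} → Adj H u v → Near u → ¬ Near v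
    near-neighbor uv near near′ = h-proper uv (≡.trans near (≡.sym near′))

    far-¬Mono : ∀ {u v} → ¬ Near u → Adj H u v → Mono H t u → ¬ Mono H t v
    far-¬Mono {u} {v} far uv mono-u mono-v with internal? u
    -- The root is near, so `u` is not the root. Its parent and child are near, hence colored by
    -- depth.
    ... | yes i with internal-path (λ { refl → far refl }) i
    ...   | w , u-par , uw , dw = alternate-depth dw (bit-injective
              (≡.trans (≡.sym (t-near (far-neighbor u-par far)))
                (≡.trans (mono-u u-par uw) (t-near (far-neighbor uw far)))))
    -- Now `v` is near, so its neighbors are all far: the leaf `u` has color 0 and the internal `w`
    -- has color 1.
    far-¬Mono {u} {v} far uv mono-u mono-v | no ¬i with internal-neighbor v
    ...   | w , j , vw with () ←
              ≡.trans (≡.sym (t-far-leaf far ¬i))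
                (≡.trans (mono-v (sym H uv) vw)
                  (t-far-internal (near-neighbor vw (far-neighbor uv far)) j))

    separating : Separating H t
    separating {u} {v} uv mono-u mono-v with h u ≟ h root
    ... | no far   = far-¬Mono far uv mono-u mono-v
    ... | yes near =
      far-¬Mono (near-neighbor uv near) (sym H uv) mono-v mono-u

-- Choice of the separating coloring and the bound for the product.

-- From three colors on, the tree alone determines the coloring; with exactly two, the bipartition
-- given by `h` enters as well.
separatingColoring : ∀ {H l} → Connected H → 3 ≤ n H → Colorable H l →
  Σ (Vertex H → Fin l) (Separating H)
separatingColoring {H} {l} conn 3≤n (h , h-proper) with spanningTree {H} conn 3≤n
... | L , ∈L , T = go l h h-proper
  where
  module S = SpanningTree ∈L T
  go : ∀ l (h : Vertex H → Fin l) → Proper H l h →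
    Σ (Vertex H → Fin l) (Separating H)
  go zero h _ with () ← h (Tree.root T)
  -- A proper coloring with one color leaves no edge to separate.
  go (suc zero) h h-proper = h , λ {u} {v} uv _ _ → h-proper uv (Fin1 (h u) (h v))
    where
    Fin1 : (i j : Fin 1) → i ≡ j
    Fin1 zero zero = refl
  go (suc (suc zero)) h h-proper = _ , S.TwoColors.separating h h-proper
  go (suc (suc (suc m))) _ _ = _ , S.ThreeColors.separating m

theorem7 : (G H : Graph) → Connected G → Connected H →
    2 ≤ n G → 2 ≤ n H → (3 ≤ n G ⊎ 3 ≤ n H) →
    (k l : ℕ) → IsChromaticNumber G k → IsChromaticNumber H l →
    LidAtMost (tensor G H) (k * l)
theorem7 G H connG connH _ _ (inj₂ 3≤n) k l ((f , f-proper) , _) (H-colorable , _)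
  with separatingColoring {H} connH 3≤n H-colorable
... | t , t-sep = k * l , ≤-refl , _ ,
  product-lid (tensor-isTensor G H) {f = f} {t} combine
    (combine-injective _ _ _ _) f-proper t-sep
theorem7 G H connG connH _ _ (inj₁ 3≤n) k l (G-colorable , _) ((f , f-proper) , _)
  with separatingColoring {G} connG 3≤n G-colorable
... | t , t-sep = k * l , ≤-refl , _ ,
  -- Here `t` colors `G`; `flip` keeps the color of `G` in the first place, so that the pairs are
  -- coded in `Fin (k * l)`.
  product-lid (IsTensor-comm (tensor-isTensor G H)) {f = f} {t} (flip combine)
    (swap ∘ combine-injective _ _ _ _) f-proper t-sep
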